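{- Suppose that $\mathcal D=(\mathcal P,\mathcal B,\mathcal I)$ is a non-trivial $G$-pairwise transitive $2$-$(v,k,\lambda)$ design, where $G\le\mathrm{Aut}(\mathcal D)$, and that $G^{\mathcal B}$ has rank $3$. Let $r$ be the number of blocks incident with a point. Then $3\le k\le v/2$, $3\le r\le|\mathcal B|/2$, and for $b\in\mathcal B$, the stabiliser $G_b$ has an orbit on $\mathcal P$ of size $k$.
   Context: A design $\mathcal D=(\mathcal P,\mathcal B,\mathcal I)$ consists of finite sets $\mathcal P$ (points), $\mathcal B$ (blocks) and an incidence relation $\mathcal I\subseteq\mathcal P\times\mathcal B$. It is a $2$-$(v,k,\lambda)$ design (or $2$-design) if $|\mathcal P|=v$, each block is incident with exactly $k$ points, and each pair of distinct points is incident with exactly $\lambda$ common blocks. It is non-trivial if $2<k<v$. An automorphism is a permutation of $\mathcal P\cup\mathcal B$ leaving $\mathcal P$ and $\mathcal B$ invariant setwise and preserving incidence; $\mathrm{Aut}(\mathcal D)$ is the group of all automorphisms. Two blocks are intersecting if some point is incident with both. For $G\le\mathrm{Aut}(\mathcal D)$, the $2$-design $\mathcal D$ is $G$-pairwise transitive if $G$ is transitive on each of the following five (possibly empty) sets of ordered pairs: pairs of distinct points, incident point-block pairs, non-incident point-block pairs, pairs of distinct intersecting blocks, pairs of non-intersecting blocks. $G^{\mathcal B}$ is the permutation group induced by $G$ on $\mathcal B$. A transitive permutation group has rank $n$ if a point stabiliser has exactly $n$ orbits. -}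

module Defs where

open import Algebra.Bundles using (Group)
open import Data.Fin.Base using (Fin)
open import Data.Fin.Permutation using (Permutation′; _⟨$⟩ʳ_; _⟨$⟩ˡ_; _∘ₚ_; flip; inverseˡ; inverseʳ) renaming (_≈_ to _≈ₚ_; id to idₚ)
open import Data.Fin.Subset using (Subset; _∈_; _∩_; ∣_∣)
open import Data.Nat.Base using (ℕ; _<_)
open import Data.Product.Base using (_×_; _,_; ∃-syntax; Σ-syntax; map)
open import Data.Vec.Base using (tabulate)
open import Function.Bundles using (_⇔_; mk⇔; Equivalence)
open import Level using (Level; 0ℓ; _⊔_) renaming (suc to lsuc)
open import Relation.Binary.Core using (REL)
open import Relation.Binary.Definitions using (Decidable)
open import Relation.Binary.PropositionalEquality using (_≡_; _≢_; refl; sym; trans; cong; subst₂)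
open import Relation.Nullary using (¬_; does)
open import Relation.Unary using (Pred)

record Subgroup {c ℓ : Level} (𝔾 : Group c ℓ) : Set (c ⊔ ℓ ⊔ lsuc 0ℓ) where
  open Group 𝔾 using (Carrier; _≈_; _∙_; ε; _⁻¹)
  field
    Member    : Pred Carrier 0ℓ
    resp      : ∀ {g h} → g ≈ h → Member g → Member h
    ε-closed  : Member ε
    ∙-closed  : ∀ {g h} → Member g → Member h → Member (g ∙ h)
    ⁻¹-closed : ∀ {g} → Member g → Member (g ⁻¹)

flip-cong : ∀ {n} (π ρ : Permutation′ n) → π ≈ₚ ρ → flip π ≈ₚ flip ρ
flip-cong π ρ π≈ρ i = trans (cong (π ⟨$⟩ˡ_) (sym (trans (π≈ρ (ρ ⟨$⟩ˡ i)) (inverseʳ ρ)))) (inverseˡ π)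

-- Products are in diagrammatic order: π ∘ₚ ρ applies π first.
Sym : ℕ → Group 0ℓ 0ℓ
Sym n = record
  { Carrier = Permutation′ n
  ; _≈_     = _≈ₚ_
  ; _∙_     = _∘ₚ_
  ; ε       = idₚ
  ; _⁻¹     = flip
  ; isGroup = record
    { isMonoid = record
      { isSemigroup = record
        { isMagma = record
          { isEquivalence = record
            { refl  = λ _ → refl
            ; sym   = λ p i → sym (p i)
            ; trans = λ p q i → trans (p i) (q i)
            }
          ; ∙-cong = λ {π} {π′} {ρ} {ρ′} p q i → trans (cong (ρ ⟨$⟩ʳ_) (p i)) (q (π′ ⟨$⟩ʳ i))
          }
        ; assoc = λ _ _ _ _ → refl
        }
      ; identity = (λ _ _ → refl) , (λ _ _ → refl)
      }
    ; inverse = (λ π _ → inverseʳ π) , (λ π _ → inverseˡ π)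
    ; ⁻¹-cong = λ {π} {ρ} → flip-cong π ρ
    }
  }

PermGroup : ℕ → Set₁
PermGroup n = Subgroup (Sym n)

module _ {n : ℕ} (H : PermGroup n) where
  open Subgroup H

  SameOrbit : Fin n → Fin n → Set
  SameOrbit x y = ∃[ σ ] Member σ × σ ⟨$⟩ʳ x ≡ y

  IsOrbit : Subset n → Set
  IsOrbit S = ∃[ x ] (∀ y → (y ∈ S) ⇔ SameOrbit x y)

  -- "Exactly m orbits": there is a transversal of the orbits indexed by Fin m.
  HasOrbitCount : ℕ → Set
  HasOrbitCount m = Σ[ rep ∈ (Fin m → Fin n) ]
    (∀ (i j : Fin m) → SameOrbit (rep i) (rep j) → i ≡ j) × (∀ x → ∃[ i ] SameOrbit (rep i) x)

  IsTransitive : Set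
  IsTransitive = ∀ x y → SameOrbit x y

  stabiliser : Fin n → PermGroup n
  stabiliser x = record
    { Member    = λ σ → Member σ × σ ⟨$⟩ʳ x ≡ x
    ; resp      = λ { p (m , e) → resp p m , trans (sym (p x)) e }
    ; ε-closed  = ε-closed , refl
    ; ∙-closed  = λ { {_} {h} (m , e) (m′ , e′) → ∙-closed m m′ , trans (cong (h ⟨$⟩ʳ_) e) e′ }
    ; ⁻¹-closed = λ { {g} (m , e) → ⁻¹-closed m , trans (cong (g ⟨$⟩ˡ_) (sym e)) (inverseˡ g) }
    }

-- By transitivity all point stabilisers have the same number of orbits; asking for
-- one of them, rather than all, means that a group of degree 0 has no rank.
HasRank : ∀ {n} → PermGroup n → ℕ → Set
HasRank H m = IsTransitive H × ∃[ x ] HasOrbitCount (stabiliser H x) m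

-- v points and b blocks; distinct blocks may be incident with the same points.
record Design (v b : ℕ) : Set₁ where
  field
    _I_  : REL (Fin v) (Fin b) 0ℓ
    _I?_ : Decidable _I_

  pointsOn : Fin b → Subset v
  pointsOn β = tabulate (λ p → does (p I? β))

  blocksThrough : Fin v → Subset b
  blocksThrough p = tabulate (λ β → does (p I? β))

  Intersecting : Fin b → Fin b → Set
  Intersecting β γ = ∃[ p ] p I β × p I γ

-- A permutation of the disjoint union of points and blocks that leaves both parts
-- invariant is a pair of permutations.
record Automorphism {v b : ℕ} (D : Design v b) : Set where
  open Design D
  field
    onPoints  : Permutation′ v
    onBlocks  : Permutation′ b
    preserves : ∀ p β → (p I β) ⇔ ((onPoints ⟨$⟩ʳ p) I (onBlocks ⟨$⟩ʳ β))

open Automorphism public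

module _ {v b : ℕ} (D : Design v b) where
  open Design D
  private
    module V = Group (Sym v)
    module B = Group (Sym b)

  Aut : Group 0ℓ 0ℓ
  Aut = record
    { Carrier = Automorphism D
    ; _≈_     = λ g h → onPoints g ≈ₚ onPoints h × onBlocks g ≈ₚ onBlocks h
    ; _∙_     = λ g h → record
      { onPoints  = onPoints g ∘ₚ onPoints h
      ; onBlocks  = onBlocks g ∘ₚ onBlocks h
      ; preserves = λ p β → mk⇔
          (λ i → Equivalence.to (preserves h _ _) (Equivalence.to (preserves g p β) i))
          (λ i → Equivalence.from (preserves g p β) (Equivalence.from (preserves h _ _) i))
      }
    ; ε       = record { onPoints = idₚ ; onBlocks = idₚ ; preserves = λ _ _ → mk⇔ (λ i → i) (λ i → i) }
    ; _⁻¹     = λ g → record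
      { onPoints  = flip (onPoints g)
      ; onBlocks  = flip (onBlocks g)
      ; preserves = λ p β → mk⇔
          (λ i → Equivalence.from (preserves g _ _)
                   (subst₂ _I_ (sym (inverseʳ (onPoints g))) (sym (inverseʳ (onBlocks g))) i))
          (λ i → subst₂ _I_ (inverseʳ (onPoints g)) (inverseʳ (onBlocks g))
                   (Equivalence.to (preserves g _ _) i))
      }
    ; isGroup = record
      { isMonoid = record
        { isSemigroup = record
          { isMagma = record
            { isEquivalence = record
              { refl  = (λ _ → refl) , (λ _ → refl)
              ; sym   = λ { (p , q) → (λ i → sym (p i)) , (λ i → sym (q i)) }
              ; trans = λ { (p , q) (p′ , q′) → (λ i → trans (p i) (p′ i)) , (λ i → trans (q i) (q′ i)) }
              }
            ; ∙-cong = λ { {g} {g′} {h} {h′} (p , q) (p′ , q′) →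
                V.∙-cong {onPoints g} {onPoints g′} {onPoints h} {onPoints h′} p p′
              , B.∙-cong {onBlocks g} {onBlocks g′} {onBlocks h} {onBlocks h′} q q′ }
            }
          ; assoc = λ _ _ _ → (λ _ → refl) , (λ _ → refl)
          }
        ; identity = (λ _ → (λ _ → refl) , (λ _ → refl)) , (λ _ → (λ _ → refl) , (λ _ → refl))
        }
      ; inverse = (λ g → (λ _ → inverseʳ (onPoints g)) , (λ _ → inverseʳ (onBlocks g)))
                , (λ g → (λ _ → inverseˡ (onPoints g)) , (λ _ → inverseˡ (onBlocks g)))
      ; ⁻¹-cong = λ { {g} {h} (p , q) →
            flip-cong (onPoints g) (onPoints h) p , flip-cong (onBlocks g) (onBlocks h) q }
      }
    }

  record Is2Design (k λ′ : ℕ) : Set where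
    field
      blockSize : ∀ β → ∣ pointsOn β ∣ ≡ k
      balanced  : ∀ p q → p ≢ q → ∣ blocksThrough p ∩ blocksThrough q ∣ ≡ λ′

NonTrivial : (v k : ℕ) → Set
NonTrivial v k = 2 < k × k < v

module _ {v b : ℕ} {D : Design v b} where

  actPP : Automorphism D → Fin v × Fin v → Fin v × Fin v
  actPP g = map (onPoints g ⟨$⟩ʳ_) (onPoints g ⟨$⟩ʳ_)

  actPB : Automorphism D → Fin v × Fin b → Fin v × Fin b
  actPB g = map (onPoints g ⟨$⟩ʳ_) (onBlocks g ⟨$⟩ʳ_)

  actBB : Automorphism D → Fin b × Fin b → Fin b × Fin b
  actBB g = map (onBlocks g ⟨$⟩ʳ_) (onBlocks g ⟨$⟩ʳ_)

module _ {v b : ℕ} {D : Design v b} (G : Subgroup (Aut D)) where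
  open Design D
  open Subgroup G

  inducedOnPoints : PermGroup v
  inducedOnPoints = record
    { Member    = λ σ → ∃[ g ] Member g × onPoints g ≈ₚ σ
    ; resp      = λ { p (g , m , e) → g , m , λ i → trans (e i) (p i) }
    ; ε-closed  = Group.ε (Aut D) , ε-closed , λ _ → refl
    ; ∙-closed  = λ { {_} {τ} (g , m , e) (h , m′ , e′) →
        Group._∙_ (Aut D) g h , ∙-closed m m′ , λ i → trans (e′ _) (cong (τ ⟨$⟩ʳ_) (e i)) }
    ; ⁻¹-closed = λ { {σ} (g , m , e) →
        Group._⁻¹ (Aut D) g , ⁻¹-closed m , flip-cong (onPoints g) σ e }
    }

  inducedOnBlocks : PermGroup b
  inducedOnBlocks = record
    { Member    = λ σ → ∃[ g ] Member g × onBlocks g ≈ₚ σ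
    ; resp      = λ { p (g , m , e) → g , m , λ i → trans (e i) (p i) }
    ; ε-closed  = Group.ε (Aut D) , ε-closed , λ _ → refl
    ; ∙-closed  = λ { {_} {τ} (g , m , e) (h , m′ , e′) →
        Group._∙_ (Aut D) g h , ∙-closed m m′ , λ i → trans (e′ _) (cong (τ ⟨$⟩ʳ_) (e i)) }
    ; ⁻¹-closed = λ { {σ} (g , m , e) →
        Group._⁻¹ (Aut D) g , ⁻¹-closed m , flip-cong (onBlocks g) σ e }
    }

  blockStabiliser : Fin b → Subgroup (Aut D)
  blockStabiliser β = record
    { Member    = λ g → Member g × onBlocks g ⟨$⟩ʳ β ≡ β
    ; resp      = λ { (p , q) (m , e) → resp (p , q) m , trans (sym (q β)) e }
    ; ε-closed  = ε-closed , refl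
    ; ∙-closed  = λ { {_} {h} (m , e) (m′ , e′) → ∙-closed m m′ , trans (cong (onBlocks h ⟨$⟩ʳ_) e) e′ }
    ; ⁻¹-closed = λ { {g} (m , e) →
        ⁻¹-closed m , trans (cong (onBlocks g ⟨$⟩ˡ_) (sym e)) (inverseˡ (onBlocks g)) }
    }

  TransitiveOn : {A : Set} → (Automorphism D → A → A) → Pred A 0ℓ → Set
  TransitiveOn act S = ∀ {x y} → S x → S y → ∃[ g ] Member g × act g x ≡ y

  record PairwiseTransitive : Set where
    field
      distinctPoints        : TransitiveOn actPP λ (p , q) → p ≢ q
      flags                 : TransitiveOn actPB λ (p , β) → p I β
      antiflags             : TransitiveOn actPB λ (p , β) → ¬ (p I β)
      intersectingBlocks    : TransitiveOn actBB λ (β , γ) → β ≢ γ × Intersecting β γ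
      nonIntersectingBlocks : TransitiveOn actBB λ (β , γ) → ¬ Intersecting β γ

{-# OPTIONS --safe #-}
-- Rank 3 forces a block disjoint from each given block: otherwise all blocks
-- distinct from β would meet it and form a single orbit of G_β. Two disjoint
-- blocks give 2k ≤ v, and vr = bk turns this into 2r ≤ |B|. For r ≥ 3, take
-- β through p and γ disjoint from β. Each point of γ is joined to p by a block
-- other than β; if r ≤ 2 this is always the same block, which would then contain
-- γ ∪ {p}, that is, more than k points. Finally, flag-transitivity makes the
-- points of β an orbit of G_β.
module Submission where

open import Defs
open import Data.Bool.Base using (Bool; true; false; if_then_else_)
open import Data.Fin using (Fin; zero; suc)
open import Data.Fin.Patterns using (0F; 1F; 2F)
open import Data.Fin.Permutation using (_⟨$⟩ʳ_; _⟨$⟩ˡ_; inverseʳ) renaming (id to idₚ)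
open import Data.Fin.Properties using (_≟_; any?)
open import Data.Fin.Subset using (Subset; ∣_∣; _∈_; _∉_; _∩_; ∁; ⊥; ⊤; ⁅_⁆)
open import Data.Fin.Subset.Properties using (_∈?_; p⊆q⇒∣p∣≤∣q∣; ∣⊥∣≡0; ∣⊤∣≡n; ∣⁅x⁆∣≡1; ∣p∣≤n; ∣∁p∣≡n∸∣p∣; x∈⁅x⁆; x∉p⇒x∈∁p; x∈p∩q⁺; x∈p∩q⁻; x∈p∧x≢y⇒x∈p-y; x∈p⇒∣p-x∣<∣p∣)
open import Data.Nat using (ℕ; zero; suc; _≤_; _<_; _+_; _*_; _∸_; z≤n; s≤s; _≤?_; >-nonZero)
open import Data.Nat.Properties using (+-0-commutativeMonoid; ≤-trans; ≤-reflexive; <-≤-trans; ≤-<-trans; <⇒≤; <⇒≱; n≮n; +-identityʳ; +-monoˡ-≤; m∸n+n≡m; *-cancelʳ-≤; *-monoʳ-≤; *-assoc; *-comm; module ≤-Reasoning)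
open import Algebra.Properties.CommutativeMonoid.Sum +-0-commutativeMonoid using (sum; sum-cong-≗; ∑-comm; sum-permute)
open import Data.Product using (_×_; _,_; proj₁; proj₂; ∃-syntax)
open import Data.Product.Properties using (,-injective)
open import Data.Vec using (tabulate)
open import Data.Vec.Properties using (lookup∘tabulate; []=⇒lookup; lookup⇒[]=)
open import Function using (_∘_; mk⇔; Equivalence)
open import Relation.Binary.PropositionalEquality using (_≡_; _≢_; refl; sym; trans; cong; cong₂; subst; subst₂; module ≡-Reasoning)
open import Relation.Nullary using (¬_; Dec; yes; no; does; ¬?; contradiction; _×-dec_)
open import Relation.Nullary.Decidable using (dec-true; decidable-stable; does-⇔)
open import Relation.Unary using (Pred; Decidable)

-- Finite subsets: membership and cardinality.

module _ {ℓ} {n : ℕ} {P : Pred (Fin n) ℓ} (P? : Decidable P) where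

  ∈-tabulate⁺ : ∀ {x} → P x → x ∈ tabulate (does ∘ P?)
  ∈-tabulate⁺ {x} px = lookup⇒[]= x _ (trans (lookup∘tabulate (does ∘ P?) x) (dec-true (P? x) px))

  ∈-tabulate⁻ : ∀ {x} → x ∈ tabulate (does ∘ P?) → P x
  ∈-tabulate⁻ {x} x∈ with P? x | trans (sym (lookup∘tabulate (does ∘ P?) x)) ([]=⇒lookup x∈)
  ... | yes px | _ = px
  ... | no _ | ()

∣p∣<∣q∣⇒∃∈q∉p : ∀ {n} (p q : Subset n) → ∣ p ∣ < ∣ q ∣ → ∃[ x ] x ∈ q × x ∉ p
∣p∣<∣q∣⇒∃∈q∉p p q p<q with any? (λ x → (x ∈? q) ×-dec ¬? (x ∈? p))
... | yes found = found
... | no none = contradiction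
  (p⊆q⇒∣p∣≤∣q∣ λ {x} x∈q → decidable-stable (x ∈? p) λ x∉p → none (x , x∈q , x∉p))
  (<⇒≱ p<q)

0<∣p∣⇒nonempty : ∀ {n} (p : Subset n) → 0 < ∣ p ∣ → ∃[ x ] x ∈ p
0<∣p∣⇒nonempty {n} p 0<p =
  let x , x∈p , _ = ∣p∣<∣q∣⇒∃∈q∉p ⊥ p (subst (_< ∣ p ∣) (sym (∣⊥∣≡0 n)) 0<p) in x , x∈p

1<∣p∣⇒∃≢ : ∀ {n} (p : Subset n) x → 1 < ∣ p ∣ → ∃[ y ] y ∈ p × x ≢ y
1<∣p∣⇒∃≢ p x 1<p =
  let y , y∈p , y∉ = ∣p∣<∣q∣⇒∃∈q∉p ⁅ x ⁆ p (subst (_< ∣ p ∣) (sym (∣⁅x⁆∣≡1 x)) 1<p)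
  in y , y∈p , λ x≡y → y∉ (subst (_∈ ⁅ x ⁆) x≡y (x∈⁅x⁆ x))

-- Removing `x` and then `y` leaves `z` in place, so the size drops strictly three times as `x`, `y`
-- and `z` are taken away in turn.
threeElements : ∀ {n} {p : Subset n} {x y z} → x ∈ p → y ∈ p → z ∈ p →
                x ≢ y → x ≢ z → y ≢ z → 3 ≤ ∣ p ∣
threeElements {x = x} {y} x∈p y∈p z∈p x≢y x≢z y≢z =
  ≤-<-trans (≤-<-trans (≤-<-trans z≤n (x∈p⇒∣p-x∣<∣p∣ z∈p-x-y)) (x∈p⇒∣p-x∣<∣p∣ y∈p-x)) (x∈p⇒∣p-x∣<∣p∣ x∈p)
  where
  y∈p-x   = x∈p∧x≢y⇒x∈p-y y∈p (x≢y ∘ sym)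
  z∈p-x-y = x∈p∧x≢y⇒x∈p-y (x∈p∧x≢y⇒x∈p-y z∈p (x≢z ∘ sym)) (y≢z ∘ sym)

disjoint⇒∣p∣+∣q∣≤n : ∀ {n} (p q : Subset n) → (∀ {x} → x ∈ p → x ∉ q) → ∣ p ∣ + ∣ q ∣ ≤ n
disjoint⇒∣p∣+∣q∣≤n {n} p q disj = begin
  ∣ p ∣ + ∣ q ∣       ≤⟨ +-monoˡ-≤ ∣ q ∣ (p⊆q⇒∣p∣≤∣q∣ (x∉p⇒x∈∁p ∘ disj)) ⟩
  ∣ ∁ q ∣ + ∣ q ∣     ≡⟨ cong (_+ ∣ q ∣) (∣∁p∣≡n∸∣p∣ q) ⟩
  (n ∸ ∣ q ∣) + ∣ q ∣ ≡⟨ m∸n+n≡m (∣p∣≤n q) ⟩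
  n                   ∎
  where open ≤-Reasoning

-- Cardinalities as sums, and double counting.

indicator : Bool → ℕ
indicator s = if s then 1 else 0

∣tabulate∣≡sum : ∀ {n} (f : Fin n → Bool) → ∣ tabulate f ∣ ≡ sum (indicator ∘ f)
∣tabulate∣≡sum {zero}  f = refl
∣tabulate∣≡sum {suc n} f with f zero
... | true  = cong suc (∣tabulate∣≡sum (f ∘ suc))
... | false = ∣tabulate∣≡sum (f ∘ suc)

sum-const : ∀ n c → sum {n} (λ _ → c) ≡ n * c
sum-const zero    c = refl
sum-const (suc n) c = cong (c +_) (sum-const n c)

-- The entries of a 0-1 matrix are added up by rows and by columns. For the incidence matrix of a
-- design this is vr = bk.
doubleCounting : ∀ {m n r k} (f : Fin m → Fin n → Bool) →
  (∀ i → ∣ tabulate (f i) ∣ ≡ r) → (∀ j → ∣ tabulate (λ i → f i j) ∣ ≡ k) → m * r ≡ n * k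
doubleCounting {m} {n} {r} {k} f rows cols = begin
  m * r                                      ≡⟨ sum-const m r ⟨
  sum {m} (λ _ → r)                          ≡⟨ sum-cong-≗ (λ i → trans (sym (rows i)) (∣tabulate∣≡sum (f i))) ⟩
  sum (λ i → sum (λ j → indicator (f i j)))  ≡⟨ ∑-comm (λ i j → indicator (f i j)) ⟩
  sum (λ j → sum (λ i → indicator (f i j)))  ≡⟨ sum-cong-≗ (λ j → trans (sym (∣tabulate∣≡sum (λ i → f i j))) (cols j)) ⟩
  sum {n} (λ _ → k)                          ≡⟨ sum-const n k ⟩
  n * k                                      ∎
  where open ≡-Reasoning

-- Incidence under automorphisms.

module _ {v b : ℕ} (D : Design v b) where
  open Design D

  intersecting? : ∀ β γ → Dec (Intersecting β γ)
  intersecting? β γ = any? λ p → (p I? β) ×-dec (p I? γ)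

  -- The block permutation of `g` carries the blocks through `p` onto those through its image; on
  -- indicator sums this is a reindexing.
  automorphism-∣blocksThrough∣ : ∀ (g : Automorphism D) p →
    ∣ blocksThrough p ∣ ≡ ∣ blocksThrough (onPoints g ⟨$⟩ʳ p) ∣
  automorphism-∣blocksThrough∣ g p = begin
    ∣ blocksThrough p ∣
      ≡⟨ ∣tabulate∣≡sum (λ β → does (p I? β)) ⟩
    sum (λ β → indicator (does (p I? β)))
      ≡⟨ sum-cong-≗ (λ β → cong indicator (does-⇔ (preserves g p β) (p I? β) (p′ I? (onBlocks g ⟨$⟩ʳ β)))) ⟩
    sum (λ β → indicator (does (p′ I? (onBlocks g ⟨$⟩ʳ β))))
      ≡⟨ sum-permute (λ β → indicator (does (p′ I? β))) (onBlocks g) ⟨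
    sum (λ β → indicator (does (p′ I? β)))
      ≡⟨ ∣tabulate∣≡sum (λ β → does (p′ I? β)) ⟨
    ∣ blocksThrough p′ ∣ ∎
    where
    open ≡-Reasoning
    p′ = onPoints g ⟨$⟩ʳ p

-- Consequences of the 2-design axioms.

module _ {v b k λ′ : ℕ} {D : Design v b} (2-design : Is2Design D k λ′) (2<k : 2 < k) where
  open Design D
  open Is2Design 2-design

  blockNonempty : ∀ β → ∃[ p ] p I β
  blockNonempty β =
    let p , p∈β = 0<∣p∣⇒nonempty (pointsOn β) (subst (0 <_) (sym (blockSize β)) (≤-trans (s≤s z≤n) 2<k))
    in p , ∈-tabulate⁻ (_I? β) p∈β

  -- Any block `β₀` has two distinct points, so λ is positive, and by balance every pair of points
  -- then has a common block. Some block has to be given, since without blocks λ is 0.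
  joined : Fin b → ∀ {p q} → p ≢ q → ∃[ β ] p I β × q I β
  joined β₀ {p} {q} p≢q =
    let x , xIβ₀ = blockNonempty β₀
        y , y∈β₀ , x≢y = 1<∣p∣⇒∃≢ (pointsOn β₀) x (subst (1 <_) (sym (blockSize β₀)) (≤-trans (s≤s (s≤s z≤n)) 2<k))
        β₀∈ = x∈p∩q⁺ (∈-tabulate⁺ (x I?_) xIβ₀ , ∈-tabulate⁺ (y I?_) (∈-tabulate⁻ (_I? β₀) y∈β₀))
        0<λ = subst (0 <_) (balanced x y x≢y) (≤-<-trans z≤n (x∈p⇒∣p-x∣<∣p∣ β₀∈))
        β , β∈ = 0<∣p∣⇒nonempty (blocksThrough p ∩ blocksThrough q) (subst (0 <_) (sym (balanced p q p≢q)) 0<λ)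
        β∈p , β∈q = x∈p∩q⁻ (blocksThrough p) (blocksThrough q) β∈
    in β , ∈-tabulate⁻ (p I?_) β∈p , ∈-tabulate⁻ (q I?_) β∈q

  disjointBlocks⇒2k≤v : ∀ {β γ} → ¬ Intersecting β γ → 2 * k ≤ v
  disjointBlocks⇒2k≤v {β} {γ} disj = begin
    2 * k                             ≡⟨ cong (k +_) (+-identityʳ k) ⟩
    k + k                             ≡⟨ cong₂ _+_ (blockSize β) (blockSize γ) ⟨
    ∣ pointsOn β ∣ + ∣ pointsOn γ ∣   ≤⟨ disjoint⇒∣p∣+∣q∣≤n (pointsOn β) (pointsOn γ)
                                           (λ x∈β x∈γ → disj (_ , ∈-tabulate⁻ (_I? β) x∈β , ∈-tabulate⁻ (_I? γ) x∈γ)) ⟩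
    v                                 ∎
    where open ≤-Reasoning

  disjointBlocks⇒3≤r : ∀ {p β γ} → p I β → ¬ Intersecting β γ → 3 ≤ ∣ blocksThrough p ∣
  disjointBlocks⇒3≤r {p} {β} {γ} pIβ disj with 3 ≤? ∣ blocksThrough p ∣
  ... | yes 3≤r = 3≤r
  ... | no  3≰r = contradiction (<-≤-trans γ<δ (≤-reflexive (trans (blockSize δ) (sym (blockSize γ))))) (n≮n _)
    where
    p≢ : ∀ {q} → q I γ → p ≢ q
    p≢ qIγ refl = disj (p , pIβ , qIγ)

    β≢ : ∀ {q ε} → q I γ → q I ε → β ≢ ε
    β≢ qIγ qIε refl = disj (_ , qIε , qIγ)

    -- One point of `γ` singles out the block `δ` through `p` that is to contain all of `γ`.
    q₀Iγ = proj₂ (blockNonempty γ)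
    δ    = proj₁ (joined β (p≢ q₀Iγ))
    pIδ  = proj₁ (proj₂ (joined β (p≢ q₀Iγ)))
    q₀Iδ = proj₂ (proj₂ (joined β (p≢ q₀Iγ)))

    γ⊆δ : ∀ {q} → q I γ → q I δ
    γ⊆δ qIγ with joined β (p≢ qIγ)
    ... | ε , pIε , qIε with δ ≟ ε
    ...   | yes refl = qIε
    -- Now `β`, `δ`, `ε` are three distinct blocks through `p`: the last two meet `γ`, whereas `β`
    -- does not.
    ...   | no δ≢ε   = contradiction
      (threeElements (∈-tabulate⁺ (p I?_) pIβ) (∈-tabulate⁺ (p I?_) pIδ) (∈-tabulate⁺ (p I?_) pIε)
        (β≢ q₀Iγ q₀Iδ) (β≢ qIγ qIε) δ≢ε)
      3≰r

    -- The point `p` is on `δ` but not on `γ`, so `γ` fits into `δ` with `p` removed, although all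
    -- blocks have `k` points.
    γ<δ : ∣ pointsOn γ ∣ < ∣ pointsOn δ ∣
    γ<δ = ≤-<-trans
      (p⊆q⇒∣p∣≤∣q∣ λ q∈γ → let qIγ = ∈-tabulate⁻ (_I? γ) q∈γ in
        x∈p∧x≢y⇒x∈p-y (∈-tabulate⁺ (_I? δ) (γ⊆δ qIγ)) (p≢ qIγ ∘ sym))
      (x∈p⇒∣p-x∣<∣p∣ (∈-tabulate⁺ (_I? δ) pIδ))

-- Consequences of pairwise transitivity.

module _ {v b : ℕ} {D : Design v b} (G : Subgroup (Aut D)) (pt : PairwiseTransitive G) where
  open Design D
  open Subgroup G
  open PairwiseTransitive pt

  private
    module GB = Subgroup (inducedOnBlocks G)

  someDisjointPair : HasRank (inducedOnBlocks G) 3 → ∃[ β ] ∃[ γ ] ¬ Intersecting β γ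
  someDisjointPair (_ , β , rep , separated , _) with any? (λ γ → ¬? (intersecting? D β γ))
  ... | yes (γ , disj) = β , γ , disj
  ... | no allMeet = tooManyReps
    where
    meets : ∀ γ → Intersecting β γ
    meets γ = decidable-stable (intersecting? D β γ) λ disj → allMeet (γ , disj)

    bothβ : ∀ i j → rep i ≡ β → rep j ≡ β → i ≡ j
    bothβ i j i≡ j≡ = separated i j (idₚ , (GB.ε-closed , refl) , trans i≡ (sym j≡))

    -- An element of `G` taking the pair (`β`, `rep i`) to (`β`, `rep j`) fixes `β`, so the two
    -- representatives share an orbit of the stabiliser.
    neitherβ : ∀ i j → rep i ≢ β → rep j ≢ β → i ≡ j
    neitherβ i j i≢ j≢ =
      let g , m , e = intersectingBlocks {β , rep i} {β , rep j} (i≢ ∘ sym , meets _) (j≢ ∘ sym , meets _)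
          fixes , moves = ,-injective e
      in separated i j (onBlocks g , ((g , m , λ _ → refl) , fixes) , moves)

    tooManyReps : ∃[ β′ ] ∃[ γ ] ¬ Intersecting β′ γ
    -- Pigeonhole: among three representatives, two agree on whether they equal `β`.
    tooManyReps with rep 0F ≟ β | rep 1F ≟ β | rep 2F ≟ β
    ... | yes p | yes q | _     = contradiction (bothβ 0F 1F p q) λ ()
    ... | yes p | no _  | yes q = contradiction (bothβ 0F 2F p q) λ ()
    ... | no _  | yes p | yes q = contradiction (bothβ 1F 2F p q) λ ()
    ... | no p  | no q  | _     = contradiction (neitherβ 0F 1F p q) λ ()
    ... | no p  | yes _ | no q  = contradiction (neitherβ 0F 2F p q) λ ()
    ... | yes _ | no p  | no q  = contradiction (neitherβ 1F 2F p q) λ ()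

  -- Block-transitivity moves a disjoint pair so that its first block becomes `β`; a common point of
  -- the images would pull back to a common point of the original pair.
  disjointBlock : HasRank (inducedOnBlocks G) 3 → ∀ β → ∃[ γ ] ¬ Intersecting β γ
  disjointBlock rank β with someDisjointPair rank
  ... | β₀ , γ₀ , disj with proj₁ rank β₀ β
  ...   | σ , (g , _ , g≈σ) , σβ₀≡β = onBlocks g ⟨$⟩ʳ γ₀ , λ (p , pIβ , pIgγ₀) →
    let g⁻¹p = onPoints g ⟨$⟩ˡ p
        pull : ∀ {δ} → p I (onBlocks g ⟨$⟩ʳ δ) → g⁻¹p I δ
        pull i = Equivalence.from (preserves g _ _) (subst (_I _) (sym (inverseʳ (onPoints g))) i)
    in disj (g⁻¹p , pull (subst (p I_) (sym (trans (g≈σ β₀) σβ₀≡β)) pIβ) , pull pIgγ₀)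

  -- Transitivity on points is read off from transitivity on ordered pairs of distinct points;
  -- `2 ≤ v` allows each point to be completed to such a pair.
  constant-∣blocksThrough∣ : 2 ≤ v → ∀ p q → ∣ blocksThrough p ∣ ≡ ∣ blocksThrough q ∣
  constant-∣blocksThrough∣ 2≤v p q =
    let p′ , _ , p≢p′ = 1<∣p∣⇒∃≢ ⊤ p (subst (1 <_) (sym (∣⊤∣≡n v)) 2≤v)
        q′ , _ , q≢q′ = 1<∣p∣⇒∃≢ ⊤ q (subst (1 <_) (sym (∣⊤∣≡n v)) 2≤v)
        g , _ , e = distinctPoints {p , p′} {q , q′} p≢p′ q≢q′
    in trans (automorphism-∣blocksThrough∣ D g p) (cong (∣_∣ ∘ blocksThrough) (proj₁ (,-injective e)))

  -- An element taking the flag (`p`, `β`) to (`q`, `β`) fixes `β` and moves `p` to `q`. Conversely,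
  -- elements fixing `β` keep the image of `p` on `β`.
  pointsOn-isOrbit : ∀ {p β} → p I β → IsOrbit (inducedOnPoints (blockStabiliser G β)) (pointsOn β)
  pointsOn-isOrbit {p} {β} pIβ = p , λ q → mk⇔
    (λ q∈β → let g , m , e = flags {p , β} {q , β} pIβ (∈-tabulate⁻ (_I? β) q∈β)
                 moves , fixes = ,-injective e
             in onPoints g , (g , (m , fixes) , λ _ → refl) , moves)
    (λ (σ , (g , (_ , fixes) , g≈σ) , σp≡q) →
      ∈-tabulate⁺ (_I? β) (subst₂ _I_ (trans (g≈σ p) σp≡q) fixes (Equivalence.to (preserves g p β) pIβ)))

lemma4p1 : ∀ {v b k λ′ : ℕ} (D : Design v b) (G : Subgroup (Aut D)) →
    Is2Design D k λ′ → NonTrivial v k →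
    PairwiseTransitive G →
    HasRank (inducedOnBlocks G) 3 →
    (3 ≤ k × 2 * k ≤ v)
    × (∀ (p : Fin v) (r : ℕ) → ∣ Design.blocksThrough D p ∣ ≡ r → 3 ≤ r × 2 * r ≤ b)
    × (∀ (β : Fin b) → ∃[ S ] (IsOrbit (inducedOnPoints (blockStabiliser G β)) S × ∣ S ∣ ≡ k))
lemma4p1 {v} {b} {k} D G 2-design (2<k , k<v) pt rank =
    (2<k , 2k≤v)
  , (λ { p r refl → 3≤r p , 2r≤b p })
  , λ β → pointsOn β , pointsOn-isOrbit G pt (proj₂ (blockNonempty 2-design 2<k β)) , blockSize β
  where
  open Design D
  open Is2Design 2-design

  2≤v : 2 ≤ v
  2≤v = ≤-trans (<⇒≤ 2<k) (<⇒≤ k<v)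

  -- The rank hypothesis names a block whose stabiliser is considered, so the design has at least
  -- one.
  β₀ = proj₁ (proj₂ rank)

  2k≤v : 2 * k ≤ v
  2k≤v = disjointBlocks⇒2k≤v 2-design 2<k (proj₂ (disjointBlock G pt rank β₀))

  3≤r : ∀ p → 3 ≤ ∣ blocksThrough p ∣
  3≤r p =
    let q , _ , p≢q = 1<∣p∣⇒∃≢ ⊤ p (subst (1 <_) (sym (∣⊤∣≡n v)) 2≤v)
        β , pIβ , _ = joined 2-design 2<k β₀ p≢q
    in disjointBlocks⇒3≤r 2-design 2<k pIβ (proj₂ (disjointBlock G pt rank β))

  2r≤b : ∀ p → 2 * ∣ blocksThrough p ∣ ≤ b
  -- Both sides are multiplied by the positive number `v`, so that vr = bk can be substituted before
  -- `2k≤v` is applied.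
  2r≤b p = *-cancelʳ-≤ _ _ v {{>-nonZero (≤-trans (s≤s z≤n) 2≤v)}} (begin
    2 * r * v   ≡⟨ *-assoc 2 r v ⟩
    2 * (r * v) ≡⟨ cong (2 *_) (*-comm r v) ⟩
    2 * (v * r) ≡⟨ cong (2 *_) (doubleCounting (λ q β → does (q I? β)) (λ q → constant-∣blocksThrough∣ G pt 2≤v q p) blockSize) ⟩
    2 * (b * k) ≡⟨ *-assoc 2 b k ⟨
    2 * b * k   ≡⟨ cong (_* k) (*-comm 2 b) ⟩
    b * 2 * k   ≡⟨ *-assoc b 2 k ⟩
    b * (2 * k) ≤⟨ *-monoʳ-≤ b 2k≤v ⟩
    b * v       ∎)
    where
    open ≤-Reasoning
    r = ∣ blocksThrough p ∣
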